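{- For any uncountable analytic set $A\subseteq L(E)$, there are a nonempty perfect set $P\subseteq A$ and an infinite-dimensional subspace $V$ of $E$ such that either (i) for all $T\in P$, $V\subseteq\ker(T)$, or (ii) for all $T\in P$, $T\restriction V$ is injective.
   Context: $F$ is a countable (possibly finite) field and $E$ is a countably infinite-dimensional $F$-vector space (with a fixed basis), regarded as a discrete set. $L(E)$ is the set of all $F$-linear maps $E\to E$ with the topology inherited as a subspace of the product space $E^E$; it is an uncountable Polish space. -}

module Defs where

open import Level using (Level; _⊔_)
open import Algebra.Apartness.Bundles using (HeytingField; HeytingCommutativeRing)
open import Algebra.Bundles using (CommutativeRing)
open import Algebra.Module.Bundles using (Module)
open import Algebra.Module.Morphism.Structures using (module ModuleMorphisms)
import Algebra.Properties.Monoid.Sum as Sum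
open import Data.Fin.Base using (toℕ)
open import Data.List.Base using (List)
open import Data.List.Relation.Unary.All using (All)
open import Data.Nat.Base using (ℕ)
open import Data.Product.Base using (Σ; ∃; ∃₂; _×_; proj₁)
open import Data.Sum.Base using (_⊎_)
open import Data.Vec.Functional using (Vector)
open import Function.Base using (_∘_)
open import Function.Bundles using (Injection; _⇔_)
open import Relation.Binary.Bundles using (Setoid)
import Relation.Binary.Construct.On as On
open import Relation.Binary.PropositionalEquality using (_≡_)
import Relation.Binary.PropositionalEquality.Properties as ≡
open import Relation.Nullary.Negation using (¬_)
open import Relation.Unary using (Pred; Empty)

private variable
  c ℓ₁ ℓ₂ m ℓm p : Level

-- Finite or countably infinite.
Countable : Setoid c ℓ₁ → Set (c ⊔ ℓ₁)
Countable S = Injection S (≡.setoid ℕ)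

-- In the presence of excluded middle, the apartness of a Heyting field is
-- _≉_, so that Heyting fields are exactly fields.
fieldRing : HeytingField c ℓ₁ ℓ₂ → CommutativeRing c ℓ₁
fieldRing F = HeytingCommutativeRing.commutativeRing
                (HeytingField.heytingCommutativeRing F)

fieldSetoid : HeytingField c ℓ₁ ℓ₂ → Setoid c ℓ₁
fieldSetoid F = CommutativeRing.setoid (fieldRing F)

-- Baire space is ℕ → ℕ with the product topology; the basic neighbourhoods
-- of x are { y | y ≈ᴮ[ ks ] x } for ks a finite list of coordinates.
_≈ᴮ[_]_ : (ℕ → ℕ) → List ℕ → (ℕ → ℕ) → Set
x ≈ᴮ[ ks ] y = All (λ k → x k ≡ y k) ks

module VectorSpace {c ℓ₁ ℓ₂ m ℓm : Level} (F : HeytingField c ℓ₁ ℓ₂)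
                   (E : Module (fieldRing F) m ℓm) where

  open HeytingField F using () renaming (Carrier to K; _≈_ to _≈ᴷ_; 0# to 0ᴷ)
  open Module E
  open Sum +ᴹ-monoid using (sum)

  linComb : ∀ {n} → Vector K n → Vector Carrierᴹ n → Carrierᴹ
  linComb a v = sum (λ i → a i *ₗ v i)

  -- A basis indexed by ℕ, i.e. E has countably infinite dimension.
  record IsBasis (e : ℕ → Carrierᴹ) : Set (c ⊔ ℓ₁ ⊔ m ⊔ ℓm) where
    field
      independent : ∀ n (a : Vector K n) → linComb a (e ∘ toℕ) ≈ᴹ 0ᴹ →
                    ∀ i → a i ≈ᴷ 0ᴷ
      spanning    : ∀ u → ∃₂ λ n (a : Vector K n) → u ≈ᴹ linComb a (e ∘ toℕ)

  record IsSubspace (V : Pred Carrierᴹ p) : Set (c ⊔ m ⊔ ℓm ⊔ p) where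
    field
      resp     : ∀ {u w} → u ≈ᴹ w → V u → V w
      0-closed : V 0ᴹ
      +-closed : ∀ {u w} → V u → V w → V (u +ᴹ w)
      *-closed : ∀ a {u} → V u → V (a *ₗ u)

  FiniteDimensional : Pred Carrierᴹ p → Set (c ⊔ m ⊔ ℓm ⊔ p)
  FiniteDimensional V = ∃₂ λ n (v : Vector Carrierᴹ n) →
    (∀ i → V (v i)) × (∀ u → V u → ∃ λ a → u ≈ᴹ linComb a v)

  InfiniteDimensional : Pred Carrierᴹ p → Set (c ⊔ m ⊔ ℓm ⊔ p)
  InfiniteDimensional V = ¬ FiniteDimensional V

  record Lin : Set (c ⊔ m ⊔ ℓm) where
    field
      map      : Carrierᴹ → Carrierᴹ
      isLinear : ModuleMorphisms.IsModuleHomomorphism rawModule rawModule map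

  open Lin public using (map)

  ker : Lin → Pred Carrierᴹ ℓm
  ker T u = map T u ≈ᴹ 0ᴹ

  InjectiveOn : Pred Carrierᴹ p → Lin → Set (m ⊔ ℓm ⊔ p)
  InjectiveOn V T = ∀ {u w} → V u → V w → map T u ≈ᴹ map T w → u ≈ᴹ w

  linSetoid : Setoid (c ⊔ m ⊔ ℓm) (m ⊔ ℓm)
  linSetoid = record
    { Carrier       = Lin
    ; _≈_           = λ S T → ∀ u → map S u ≈ᴹ map T u
    ; isEquivalence = record
      { refl  = λ _ → ≈ᴹ-refl
      ; sym   = λ S≈T u → ≈ᴹ-sym (S≈T u)
      ; trans = λ S≈T T≈U u → ≈ᴹ-trans (S≈T u) (T≈U u)
      }
    }

  open Setoid linSetoid public using () renaming (_≈_ to _≈ᴸ_)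

  CountableSubset : Pred Lin p → Set (c ⊔ m ⊔ ℓm ⊔ p)
  CountableSubset A = Countable (On.setoid linSetoid (proj₁ {B = A}))

  -- The topology inherited from the product topology on functions E → E, with
  -- E discrete: the basic neighbourhoods of T are { S | S ≈[ us ] T }.
  _≈[_]_ : Lin → List Carrierᴹ → Lin → Set (m ⊔ ℓm)
  S ≈[ us ] T = All (λ u → map S u ≈ᴹ map T u) us

  Continuous : ((ℕ → ℕ) → Lin) → Set (m ⊔ ℓm)
  Continuous f = ∀ x us → ∃ λ ks → ∀ y → y ≈ᴮ[ ks ] x → f y ≈[ us ] f x

  -- Empty, or the image of Baire space under a continuous map.
  Analytic : Pred Lin p → Set (c ⊔ m ⊔ ℓm ⊔ p)
  Analytic A = Empty A ⊎
    Σ ((ℕ → ℕ) → Lin) λ f → Continuous f × (∀ T → A T ⇔ ∃ λ x → f x ≈ᴸ T)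

  Closed : Pred Lin p → Set (c ⊔ m ⊔ ℓm ⊔ p)
  Closed P = ∀ T → (∀ us → ∃ λ S → P S × S ≈[ us ] T) → P T

  NoIsolatedPoints : Pred Lin p → Set (c ⊔ m ⊔ ℓm ⊔ p)
  NoIsolatedPoints P =
    ∀ T → P T → ∀ us → ∃ λ S → P S × S ≈[ us ] T × ¬ (S ≈ᴸ T)

  Perfect : Pred Lin p → Set (c ⊔ m ⊔ ℓm ⊔ p)
  Perfect P = Closed P × NoIsolatedPoints P

{-# OPTIONS --safe #-}

-- Let A = f[Baire] and call a point x of Baire space a kernel point if f maps
-- every neighbourhood of x onto an uncountable set.  Either f y has finite
-- rank for all kernel points y in some neighbourhood of a kernel point, or the
-- kernel points y with f y of infinite rank are dense among all kernel points.
-- In either case a fusion argument builds a Cantor scheme from kernel points of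
-- that kind together with vectors v₀, v₁, …; over each cell of level n + 1 the
-- vectors v₀, …, vₙ have a fixed image.  Finitely many maps of finite rank have
-- a common kernel of finite codimension, so in the first case vₙ can be chosen
-- in the kernels of all maps at level n.  In the second case, E is not a finite
-- union of preimages T⁻¹(W) with T of infinite rank and W finite-dimensional,
-- so T vₙ can be kept outside the span of T v₀, …, T vₙ₋₁ for all maps T at
-- level n.  Keeping vₙ outside the span of e₀, …, eₙ₋₁ as well makes the span
-- of all vₙ infinite-dimensional.

module Submission where

open import Defs
open import Level using (Level; _⊔_; 0ℓ; Lift; lift; lower)
open import Algebra.Apartness.Bundles using (HeytingField)
open import Algebra.Bundles using (CommutativeMonoid; CommutativeRing)
open import Algebra.Module.Bundles using (Module)
open import Algebra.Module.Morphism.Structures using (module ModuleMorphisms)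
import Algebra.Module.Properties.Semimodule as SemimoduleProperties
import Algebra.Properties.CommutativeSemigroup as CommutativeSemigroupProperties
import Algebra.Properties.Monoid.Sum as Sum
import Algebra.Properties.Ring as RingProperties
open import Axiom.ExcludedMiddle using (ExcludedMiddle)
open import Data.Bool.Base using (Bool; true; false; not; if_then_else_)
open import Data.Empty using (⊥; ⊥-elim)
open import Data.Fin.Base using (Fin; toℕ; fromℕ; inject₁)
open import Data.Fin.Properties using (toℕ-fromℕ; toℕ-inject₁; toℕ<n)
open import Data.List.Base as List using (List; []; _∷_; _++_)
open import Data.List.Membership.Propositional using () renaming (_∈_ to _∈ᴸ_)
open import Data.List.Membership.Propositional.Properties
  using (∈-++⁺ˡ; ∈-++⁺ʳ; ∈-map⁺)
open import Data.List.Relation.Unary.All as All using (All; []; _∷_)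
import Data.List.Relation.Unary.All.Properties as All
open import Data.List.Relation.Unary.Any using (here)
open import Data.Nat.Base
  using (ℕ; zero; suc; _≤_; _<_; s≤s; z≤n; _≤′_; ≤′-refl; ≤′-step)
  renaming (_+_ to _+ᴺ_; _⊔_ to _⊔ᴺ_)
open import Data.Nat.Induction using (<-rec)
open import Data.Nat.Properties
  using (_≟_; _<?_; n≮n; ≤-refl; ≤-reflexive; ≤-trans; ≤-antisym; ≤-total;
         <-≤-trans; <⇒≢; ≮⇒≥; ≤⇒≤′; n≤1+n; n<1+n; m<n⇒m<1+n; m<1+n⇒m<n∨m≡n;
         m≤m⊔n; m≤n⊔m)
  renaming (+-suc to +ᴺ-suc; +-identityʳ to +ᴺ-identityʳ)
open import Data.Product.Base using (Σ; ∃; ∃₂; _×_; _,_; proj₁; proj₂)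
open import Data.Sum.Base using (_⊎_; inj₁; inj₂)
open import Data.Unit.Base using (⊤; tt)
open import Data.Vec.Base using (Vec; []; _∷_)
open import Data.Vec.Functional using (Vector)
open import Function.Base using (_∘_; id)
open import Function.Bundles using (Equivalence)
open import Relation.Binary.PropositionalEquality as ≡
  using (_≡_; refl; cong; subst)
import Relation.Binary.Reasoning.Setoid as SetoidReasoning
open import Relation.Nullary.Decidable
  using (yes; no; does; dec-true; dec-false; decidable-stable)
open import Relation.Nullary.Negation using (¬_)
open import Relation.Unary using (Pred; _⊆_; _∩_; Satisfiable)

private variable
  p q : Level

-- Classical principles.

module _ (em : ∀ {ℓ} → ExcludedMiddle ℓ) where

  byContradiction : {P : Set p} → ¬ ¬ P → P
  byContradiction = decidable-stable em

  ¬∀⇒∃¬ : {X : Set p} {P : X → Set q} → ¬ (∀ x → P x) → ∃ λ x → ¬ P x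
  ¬∀⇒∃¬ ¬∀ = byContradiction λ ¬∃ → ¬∀ λ x → byContradiction λ ¬Px → ¬∃ (x , ¬Px)

  -- Descends while a smaller witness exists. Minimal witnesses later serve as canonical indices.
  least : {P : Pred ℕ p} → ∃ P → ∃ λ n → P n × (∀ k → P k → n ≤ k)
  least {P = P} (n , Pn) = <-rec _ go n Pn
    where
    go : ∀ n → (∀ {k} → k < n → P k → ∃ λ n → P n × (∀ k → P k → n ≤ k)) →
         P n → ∃ λ n → P n × (∀ k → P k → n ≤ k)
    go n rec Pn with em {P = ∃ λ k → k < n × P k}
    ... | yes (k , k<n , Pk) = rec k<n Pk
    ... | no  ¬k             = n , Pn , λ k Pk → ≮⇒≥ λ k<n → ¬k (k , k<n , Pk)

-- Linear algebra: subspaces, spans, infinite dimension.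

module LinearAlgebra (em : ∀ {ℓ} → ExcludedMiddle ℓ)
  {c ℓ₁ ℓ₂ m ℓm : Level} (F : HeytingField c ℓ₁ ℓ₂)
  (E : Module (fieldRing F) m ℓm) where

  open CommutativeRing (fieldRing F) public
    using (_≈_; _+_; _*_; -_; 0#; 1#; -‿inverseˡ; -‿inverseʳ; +-identityʳ;
           +-congˡ; *-congˡ; *-assoc; *-identityˡ; *-identityʳ; -‿cong)
    renaming (Carrier to K; sym to ≈-sym; trans to ≈-trans; refl to ≈-refl)
  open Module E public
  open VectorSpace F E public
  open SemimoduleProperties semimodule using (x≈0⇒x*y≈0)
  open CommutativeSemigroupProperties
    (CommutativeMonoid.commutativeSemigroup +ᴹ-commutativeMonoid)
    using (interchange)
  open SetoidReasoning ≈ᴹ-setoid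
  open IsSubspace public
  open ModuleMorphisms.IsModuleHomomorphism public
    using (+ᴹ-homo; *ₗ-homo; 0ᴹ-homo; ⟦⟧-cong)
  open Lin public using (isLinear)

  map-+ : ∀ T {u v} → map T (u +ᴹ v) ≈ᴹ map T u +ᴹ map T v
  map-+ T = +ᴹ-homo (isLinear T) _ _

  map-* : ∀ T {a u} → map T (a *ₗ u) ≈ᴹ a *ₗ map T u
  map-* T = *ₗ-homo (isLinear T) _ _

  map-cong : ∀ T {u v} → u ≈ᴹ v → map T u ≈ᴹ map T v
  map-cong T = ⟦⟧-cong (isLinear T)

  map-0 : ∀ T → map T 0ᴹ ≈ᴹ 0ᴹ
  map-0 T = 0ᴹ-homo (isLinear T)

  map-+* : ∀ T {u a v} → map T (u +ᴹ a *ₗ v) ≈ᴹ map T u +ᴹ a *ₗ map T v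
  map-+* T = ≈ᴹ-trans (map-+ T) (+ᴹ-congˡ (map-* T))

  x-0≈x : ∀ a → a + - 0# ≈ a
  x-0≈x a = ≈-trans (+-congˡ (≈-trans (≈-sym (+-identityʳ _)) (-‿inverseˡ 0#)))
                    (+-identityʳ a)

  -- Tightness and excluded middle turn `a ≉ 0` into apartness from 0; the field then inverts
  -- `a - 0`, which is `a`.
  reciprocal : ∀ {a} → ¬ (a ≈ 0#) → ∃ λ b → b * a ≈ 1#
  reciprocal {a} a≉0 = b , ≈-trans (*-congˡ (≈-sym (x-0≈x a))) (proj₁ b-inverse)
    where
    open HeytingField F using (_#_; tight; #⇒invertible)
    a#0 : a # 0#
    a#0 = byContradiction em λ ¬a#0 → a≉0 (proj₁ (tight a 0#) ¬a#0)
    b = proj₁ (#⇒invertible a#0)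
    b-inverse = proj₂ (#⇒invertible a#0)

  +ᴹ-*-cancel : ∀ {a b} u w → a + b ≈ 0# → u +ᴹ a *ₗ w +ᴹ b *ₗ w ≈ᴹ u
  +ᴹ-*-cancel {a} {b} u w a+b≈0 = begin
    u +ᴹ a *ₗ w +ᴹ b *ₗ w    ≈⟨ +ᴹ-assoc _ _ _ ⟩
    u +ᴹ (a *ₗ w +ᴹ b *ₗ w)  ≈⟨ +ᴹ-congˡ (*ₗ-distribʳ w a b) ⟨
    u +ᴹ (a + b) *ₗ w        ≈⟨ +ᴹ-congˡ (x≈0⇒x*y≈0 a+b≈0) ⟩
    u +ᴹ 0ᴹ                  ≈⟨ +ᴹ-identityʳ u ⟩
    u                        ∎

  x-1*x≈0 : ∀ w → w +ᴹ - 1# *ₗ w ≈ᴹ 0ᴹ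
  x-1*x≈0 w = ≈ᴹ-trans (+ᴹ-congʳ (≈ᴹ-sym (≈ᴹ-trans (+ᴹ-identityˡ _) (*ₗ-identityˡ w))))
                       (+ᴹ-*-cancel 0ᴹ w (-‿inverseʳ 1#))

  0*-absorb : ∀ {a} u w → a ≈ 0# → u +ᴹ a *ₗ w ≈ᴹ u
  0*-absorb u w a≈0 = ≈ᴹ-trans (+ᴹ-congˡ (x≈0⇒x*y≈0 a≈0)) (+ᴹ-identityʳ u)

  module _ {X : Pred Carrierᴹ p} (X-sub : IsSubspace X) where

    +*-closed : ∀ {u v} a → X u → X v → X (u +ᴹ a *ₗ v)
    +*-closed a u∈X v∈X = +-closed X-sub u∈X (*-closed X-sub a v∈X)

    +*-cancelʳ : ∀ {u v} a → X v → X (u +ᴹ a *ₗ v) → X u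
    +*-cancelʳ {u} {v} a v∈X u+av∈X =
      resp X-sub (+ᴹ-*-cancel u v (-‿inverseʳ a)) (+*-closed (- a) u+av∈X v∈X)

    +-cancelˡ : ∀ {u v} → X u → X (u +ᴹ v) → X v
    +-cancelˡ {u} {v} u∈X u+v∈X = +*-cancelʳ 1# u∈X
      (resp X-sub (≈ᴹ-trans (+ᴹ-comm u v) (+ᴹ-congˡ (≈ᴹ-sym (*ₗ-identityˡ u)))) u+v∈X)

    *-cancel : ∀ {a u} → ¬ (a ≈ 0#) → X (a *ₗ u) → X u
    *-cancel {a} {u} a≉0 au∈X with reciprocal a≉0
    ... | b , ba≈1 = resp X-sub
      (≈ᴹ-trans (≈ᴹ-sym (*ₗ-assoc b a u)) (≈ᴹ-trans (*ₗ-congʳ ba≈1) (*ₗ-identityˡ u)))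
      (*-closed X-sub b au∈X)

  ∩-subspace : {X : Pred Carrierᴹ p} {Y : Pred Carrierᴹ q} →
               IsSubspace X → IsSubspace Y → IsSubspace (X ∩ Y)
  ∩-subspace X Y = record
    { resp     = λ u≈v (x , y) → resp X u≈v x , resp Y u≈v y
    ; 0-closed = 0-closed X , 0-closed Y
    ; +-closed = λ (x , y) (x′ , y′) → +-closed X x x′ , +-closed Y y y′
    ; *-closed = λ a (x , y) → *-closed X a x , *-closed Y a y
    }

  preimage-subspace : ∀ T {X : Pred Carrierᴹ p} →
                      IsSubspace X → IsSubspace (X ∘ map T)
  preimage-subspace T X = record
    { resp     = λ u≈v → resp X (map-cong T u≈v)
    ; 0-closed = resp X (≈ᴹ-sym (map-0 T)) (0-closed X)
    ; +-closed = λ x y → resp X (≈ᴹ-sym (map-+ T)) (+-closed X x y)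
    ; *-closed = λ a x → resp X (≈ᴹ-sym (map-* T)) (*-closed X a x)
    }

  zero-subspace : IsSubspace (_≈ᴹ 0ᴹ)
  zero-subspace = record
    { resp     = λ u≈v u≈0 → ≈ᴹ-trans (≈ᴹ-sym u≈v) u≈0
    ; 0-closed = ≈ᴹ-refl
    ; +-closed = λ u≈0 v≈0 → ≈ᴹ-trans (+ᴹ-cong u≈0 v≈0) (+ᴹ-identityʳ 0ᴹ)
    ; *-closed = λ a u≈0 → ≈ᴹ-trans (*ₗ-congˡ u≈0) (*ₗ-zeroʳ a)
    }

  ker-subspace : ∀ T → IsSubspace (ker T)
  ker-subspace T = preimage-subspace T zero-subspace

  -- Recursion on the list peels off one generator at a time. The coefficient belongs to a multiple
  -- to be added, so `w` itself is a member through `- 1#`.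
  Span : List Carrierᴹ → Pred Carrierᴹ (c ⊔ ℓm)
  Span []       u = Lift c (u ≈ᴹ 0ᴹ)
  Span (w ∷ ws) u = ∃ λ a → Span ws (u +ᴹ a *ₗ w)

  span-subspace : ∀ ws → IsSubspace (Span ws)
  span-subspace [] = record
    { resp     = λ u≈v (lift u≈0) → lift (resp zero-subspace u≈v u≈0)
    ; 0-closed = lift ≈ᴹ-refl
    ; +-closed = λ (lift x) (lift y) → lift (+-closed zero-subspace x y)
    ; *-closed = λ a (lift x) → lift (*-closed zero-subspace a x)
    }
  span-subspace (w ∷ ws) = record
    { resp     = λ u≈v (a , u) → a , resp S (+ᴹ-congʳ u≈v) u
    ; 0-closed = 0# , resp S (≈ᴹ-sym (0*-absorb 0ᴹ w ≈-refl)) (0-closed S)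
    ; +-closed = λ (a , u) (b , v) → a + b , resp S
        (≈ᴹ-trans (interchange _ _ _ _) (+ᴹ-congˡ (≈ᴹ-sym (*ₗ-distribʳ w a b))))
        (+-closed S u v)
    ; *-closed = λ b (a , u) → b * a , resp S
        (≈ᴹ-trans (*ₗ-distribˡ b _ _) (+ᴹ-congˡ (≈ᴹ-sym (*ₗ-assoc b a w))))
        (*-closed S b u)
    }
    where S = span-subspace ws

  span-∷ : ∀ {w ws} → Span ws ⊆ Span (w ∷ ws)
  span-∷ {w} {ws} {u} u∈ = 0# , resp (span-subspace ws) (≈ᴹ-sym (0*-absorb u w ≈-refl)) u∈

  span-head : ∀ {w ws} → Span (w ∷ ws) w
  span-head {w} {ws} = - 1# , resp (span-subspace ws)
    (≈ᴹ-sym (x-1*x≈0 w)) (0-closed (span-subspace ws))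

  span-least : ∀ {X : Pred Carrierᴹ p} → IsSubspace X → ∀ {ws} → All X ws → Span ws ⊆ X
  span-least X []         (lift u≈0) = resp X (≈ᴹ-sym u≈0) (0-closed X)
  span-least X (w∈ ∷ ws∈) (a , u+aw) = +*-cancelʳ X a w∈ (span-least X ws∈ u+aw)

  span-∋ : ∀ ws → All (Span ws) ws
  span-∋ []       = []
  span-∋ (w ∷ ws) = span-head {w} {ws} ∷ All.map (span-∷ {w} {ws}) (span-∋ ws)

  span-map : ∀ T ws → Span ws ⊆ Span (List.map (map T) ws) ∘ map T
  span-map T ws = span-least (preimage-subspace T (span-subspace _)) (All.map⁻ (span-∋ _))

  span-map-cong : ∀ {S T} ws → S ≈[ ws ] T →
                  Span (List.map (map T) ws) ⊆ Span (List.map (map S) ws)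
  span-map-cong ws S≈T = span-least (span-subspace _)
    (All.map⁺ (All.zipWith (λ (Su≈Tu , Su∈) → resp (span-subspace _) Su≈Tu Su∈)
                           (S≈T , All.map⁻ (span-∋ _))))

  linComb-closed : {X : Pred Carrierᴹ p} → IsSubspace X → ∀ {n} (a : Vector K n)
                   {v : Vector Carrierᴹ n} → (∀ i → X (v i)) → X (linComb a v)
  linComb-closed X {zero}  a v∈ = 0-closed X
  linComb-closed X {suc n} a v∈ = +-closed X (*-closed X _ (v∈ Fin.zero))
                                             (linComb-closed X (a ∘ Fin.suc) (v∈ ∘ Fin.suc))

  -- A form of infinite dimension that hands out witnesses; the finite list may contain vectors
  -- outside `X`.
  Unspannable : Pred Carrierᴹ p → Set (c ⊔ m ⊔ ℓm ⊔ p)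
  Unspannable X = ∀ ws → ∃ λ u → X u × ¬ Span ws u

  unspannable⇒infiniteDimensional : {X : Pred Carrierᴹ p} → Unspannable X → InfiniteDimensional X
  unspannable⇒infiniteDimensional unsp (n , v , _ , spans) with unsp (List.tabulate v)
  ... | u , u∈X , u∉ with spans u u∈X
  ... | a , u≈ = u∉ (resp S (≈ᴹ-sym u≈) (linComb-closed S a (All.tabulate⁻ (span-∋ _))))
    where S = span-subspace (List.tabulate v)

  -- Newest vector first, so that the head coefficient in a `Span` is that of the latest vector.
  prefix : (ℕ → Carrierᴹ) → ℕ → List Carrierᴹ
  prefix v zero    = []
  prefix v (suc n) = v n ∷ prefix v n

  prefix-∋ : ∀ v {k n} → k < n → Span (prefix v n) (v k)
  prefix-∋ v {k} {suc n} k<1+n with m<1+n⇒m<n∨m≡n k<1+n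
  ... | inj₁ k<n  = span-∷ {v n} {prefix v n} (prefix-∋ v k<n)
  ... | inj₂ refl = span-head {v n} {prefix v n}

  prefix-mono : ∀ v {k n} → k ≤ n → Span (prefix v k) ⊆ Span (prefix v n)
  prefix-mono v k≤n = go (≤⇒≤′ k≤n)
    where
    go : ∀ {k n} → k ≤′ n → Span (prefix v k) ⊆ Span (prefix v n)
    go ≤′-refl                  u∈ = u∈
    go {n = suc n} (≤′-step k≤n) u∈ = span-∷ {v n} {prefix v n} (go k≤n u∈)

  -- Connects recursive spans with the sums in `IsBasis`. The equation `b n ≡ d` is recorded because
  -- independence will be applied to that last coefficient.
  linComb-snoc : ∀ (v : ℕ → Carrierᴹ) n (a : ℕ → K) (d : K) → ∃ λ b → b n ≡ d ×
    linComb {suc n} (b ∘ toℕ) (v ∘ toℕ) ≈ᴹ linComb {n} (a ∘ toℕ) (v ∘ toℕ) +ᴹ d *ₗ v n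
  linComb-snoc v n a d = b , b-last , ≈ᴹ-trans
    (sum-init-last {n} (λ i → b (toℕ i) *ₗ v (toℕ i)))
    (≈ᴹ-reflexive (≡.cong₂ _+ᴹ_ (sum-cong-≗ init≗) last≡))
    where
    open Sum +ᴹ-monoid using (sum-init-last; sum-cong-≗)
    b : ℕ → K
    b i = if does (i <? n) then a i else d
    b-init : ∀ {i} → i < n → b i ≡ a i
    b-init {i} i<n rewrite dec-true (i <? n) i<n = refl
    b-last : b n ≡ d
    b-last rewrite dec-false (n <? n) (n≮n n) = refl
    init≗ : ∀ (i : Fin n) → b (toℕ (inject₁ i)) *ₗ v (toℕ (inject₁ i)) ≡ a (toℕ i) *ₗ v (toℕ i)
    init≗ i rewrite toℕ-inject₁ i = cong (_*ₗ v (toℕ i)) (b-init (toℕ<n i))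
    last≡ : b (toℕ (fromℕ n)) *ₗ v (toℕ (fromℕ n)) ≡ d *ₗ v n
    last≡ rewrite toℕ-fromℕ n = cong (_*ₗ v n) b-last

  span-prefix⇒linComb : ∀ v n {u} → Span (prefix v n) u →
                        ∃ λ (a : ℕ → K) → u ≈ᴹ linComb {n} (a ∘ toℕ) (v ∘ toℕ)
  span-prefix⇒linComb v zero    (lift u≈0) = (λ _ → 0#) , u≈0
  span-prefix⇒linComb v (suc n) {u} (b , u+bv∈) with span-prefix⇒linComb v n u+bv∈
  ... | a , u+bv≈ with linComb-snoc v n a (- b)
  ... | a′ , _ , a′≈ = a′ , (begin
    u                                              ≈⟨ +ᴹ-*-cancel u (v n) (-‿inverseʳ b) ⟨
    u +ᴹ b *ₗ v n +ᴹ - b *ₗ v n                    ≈⟨ +ᴹ-congʳ u+bv≈ ⟩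
    linComb {n} (a ∘ toℕ) (v ∘ toℕ) +ᴹ - b *ₗ v n  ≈⟨ a′≈ ⟨
    linComb {suc n} (a′ ∘ toℕ) (v ∘ toℕ)           ∎)

  -- 1 is its own inverse, hence apart from 0.
  1≉0 : ¬ (1# ≈ 0#)
  1≉0 1≈0 = #-irrefl 1≈0 (invertible⇒#
    (1# , ≈-trans (*-identityˡ _) (x-0≈x 1#) , ≈-trans (*-identityʳ _) (x-0≈x 1#)))
    where open HeytingField F using (#-irrefl; invertible⇒#)

  -- Bases indexed by the natural numbers.

  module Basis (e : ℕ → Carrierᴹ) (e-basis : IsBasis e) where
    open IsBasis e-basis

    -- An expression of `e n` through its predecessors gives a relation whose last coefficient is
    -- `- 1#`, and independence would make it 0.
    basis-fresh : ∀ n → ¬ Span (prefix e n) (e n)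
    basis-fresh n e∈ with span-prefix⇒linComb e n e∈
    ... | a , e≈ with linComb-snoc e n a (- 1#)
    ... | b , bn≡-1 , b≈ = 1≉0
      (≈-trans (≈-sym (+-identityʳ 1#)) (≈-trans (+-congˡ (≈-sym -1≈0)) (-‿inverseʳ 1#)))
      where
      vanishes : linComb {suc n} (b ∘ toℕ) (e ∘ toℕ) ≈ᴹ 0ᴹ
      vanishes = begin
        linComb {suc n} (b ∘ toℕ) (e ∘ toℕ)             ≈⟨ b≈ ⟩
        linComb {n} (a ∘ toℕ) (e ∘ toℕ) +ᴹ - 1# *ₗ e n  ≈⟨ +ᴹ-congʳ e≈ ⟨
        e n +ᴹ - 1# *ₗ e n                              ≈⟨ x-1*x≈0 (e n) ⟩
        0ᴹ                                              ∎
      -1≈0 : - 1# ≈ 0#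
      -1≈0 = subst (_≈ 0#) (≡.trans (cong b (toℕ-fromℕ n)) bn≡-1)
                   (independent (suc n) (b ∘ toℕ) vanishes (fromℕ n))

    ∈-span-prefix : ∀ u → ∃ λ n → Span (prefix e n) u
    ∈-span-prefix u with spanning u
    ... | n , a , u≈ = n , resp S (≈ᴹ-sym u≈) (linComb-closed S a (prefix-∋ e ∘ toℕ<n))
      where S = span-subspace (prefix e n)

    bounded-span : ∀ ws → ∃ λ n → All (Span (prefix e n)) ws
    bounded-span []       = 0 , []
    bounded-span (w ∷ ws) with ∈-span-prefix w | bounded-span ws
    ... | k , w∈ | n , ws∈ = k ⊔ᴺ n , prefix-mono e (m≤m⊔n k n) w∈ ∷
                                      All.map (prefix-mono e (m≤n⊔m k n)) ws∈

    -- A sequence that avoids the spans of longer and longer initial segments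
    -- of the basis escapes every finitely generated subspace.
    escaping⇒unspannable : {X : Pred Carrierᴹ p} (v : ℕ → Carrierᴹ) → (∀ n → X (v n)) →
                           (∀ n → ¬ Span (prefix e n) (v n)) → Unspannable X
    escaping⇒unspannable v v∈ v∉ ws with bounded-span ws
    ... | n , ws∈ = v n , v∈ n , λ vn∈ → v∉ n (span-least (span-subspace _) ws∈ vn∈)

    -- The vectors on which `S` and `T` agree form a subspace. Hence countably many test vectors
    -- tell two maps apart.
    ext-on-basis : ∀ {S T} → (∀ n → map S (e n) ≈ᴹ map T (e n)) → S ≈ᴸ T
    ext-on-basis {S} {T} S≈T u with ∈-span-prefix u
    ... | n , u∈ = span-least agree-subspace (agree n) u∈
      where
      agree-subspace : IsSubspace (λ u → map S u ≈ᴹ map T u)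
      agree-subspace = record
        { resp     = λ u≈v Su≈Tu →
            ≈ᴹ-trans (map-cong S (≈ᴹ-sym u≈v)) (≈ᴹ-trans Su≈Tu (map-cong T u≈v))
        ; 0-closed = ≈ᴹ-trans (map-0 S) (≈ᴹ-sym (map-0 T))
        ; +-closed = λ Su≈Tu Sv≈Tv →
            ≈ᴹ-trans (map-+ S) (≈ᴹ-trans (+ᴹ-cong Su≈Tu Sv≈Tv) (≈ᴹ-sym (map-+ T)))
        ; *-closed = λ a Su≈Tu →
            ≈ᴹ-trans (map-* S) (≈ᴹ-trans (*ₗ-congˡ Su≈Tu) (≈ᴹ-sym (map-* T)))
        }
      agree : ∀ n → All (λ u → map S u ≈ᴹ map T u) (prefix e n)
      agree zero    = []
      agree (suc n) = S≈T n ∷ agree n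

  -- Choosing one vector for finitely many maps of finite or of infinite rank.

  FiniteRank : Pred Lin (c ⊔ m ⊔ ℓm)
  FiniteRank T = ∃ λ ws → ∀ u → Span ws (map T u)

  -- One operator at a time: if v fails for T, then w + v works for a w good
  -- for T, provided v was chosen to avoid the span of W S and S w for the
  -- other operators S.
  jointly-avoid : ∀ Ts → All (¬_ ∘ FiniteRank) Ts → ∀ (W : Lin → List Carrierᴹ) →
                  ∃ λ v → All (λ T → ¬ Span (W T) (map T v)) Ts
  jointly-avoid []       []             W = 0ᴹ , []
  jointly-avoid (T ∷ Ts) (¬fin ∷ ¬fins) W
    with ¬∀⇒∃¬ em (λ spans → ¬fin (W T , spans))
  ... | w , Tw∉ with jointly-avoid Ts ¬fins (λ S → map S w ∷ W S)
  ... | v , Sv∉ with em {P = Span (W T) (map T v)}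
  ...   | no  Tv∉ = v , Tv∉ ∷ All.map (λ {S} Sv∉ → Sv∉ ∘ span-∷ {map S w} {W S}) Sv∉
  ...   | yes Tv∈ = w +ᴹ v
    , (λ Tw+v∈ → Tw∉ (+-cancelˡ (span-subspace (W T)) Tv∈
        (resp (span-subspace (W T)) (≈ᴹ-trans (map-+ T) (+ᴹ-comm _ _)) Tw+v∈)))
    ∷ All.map (λ {S} Sv∉ Sw+v∈ → Sv∉
        (+-cancelˡ (span-subspace (map S w ∷ W S)) (span-head {map S w} {W S})
          (span-∷ {map S w} {W S} (resp (span-subspace (W S)) (map-+ S) Sw+v∈)))) Sv∉

  -- The kernel of a map with finite-dimensional range has finite codimension. Each step of the
  -- induction on `ws` confines the image to the span of one generator fewer.
  unspannable-∩-ker : ∀ T ws {X : Pred Carrierᴹ (c ⊔ ℓm)} → IsSubspace X → Unspannable X →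
                      X ⊆ Span ws ∘ map T → Unspannable (X ∩ ker T)
  unspannable-∩-ker T [] X unsp T⊆ us with unsp us
  ... | u , u∈X , u∉ = u , (u∈X , lower (T⊆ u∈X)) , u∉
  unspannable-∩-ker T (w ∷ ws) {X} X-sub unsp T⊆
    with em {P = ∃ λ x → X x × ¬ Span ws (map T x)}
  ... | no ¬x = unspannable-∩-ker T ws X-sub unsp
    λ {u} u∈X → byContradiction em λ Tu∉ → ¬x (u , u∈X , Tu∉)
  ... | yes (x , x∈X , Tx∉) = λ us → let u , (u∈X′ , Tu≈0) , u∉ = unsp-ker us
                                     in u , (proj₁ u∈X′ , Tu≈0) , u∉
    where
    S = span-subspace ws
    a = proj₁ (T⊆ x∈X)
    Tx+aw∈ : Span ws (map T x +ᴹ a *ₗ w)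
    Tx+aw∈ = proj₂ (T⊆ x∈X)
    a≉0 : ¬ (a ≈ 0#)
    a≉0 a≈0 = Tx∉ (resp S (0*-absorb _ w a≈0) Tx+aw∈)
    b = proj₁ (reciprocal a≉0)

    -- T moves X into Span ws up to multiples of w, which subtracting a
    -- multiple of x removes.
    unsp-preimage : Unspannable (X ∩ (Span ws ∘ map T))
    -- Avoiding `x` as well leaves `u +ᴹ d *ₗ x` outside `Span us` for every `d`.
    unsp-preimage us with unsp (x ∷ us)
    ... | u , u∈X , u∉ =
      u +ᴹ d *ₗ x , (+*-closed X-sub d u∈X x∈X , Tu+dx∈) , λ u+dx∈ → u∉ (d , u+dx∈)
      where
      a′ = proj₁ (T⊆ u∈X)
      -- `b` inverts `a`, so `d * a` cancels the coefficient `a′` of `w`.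
      d = - (a′ * b)
      a′+da≈0 : a′ + d * a ≈ 0#
      a′+da≈0 = ≈-trans (+-congˡ (≈-trans (≈-sym (-‿distribˡ-* _ _))
        (-‿cong (≈-trans (*-assoc _ _ _)
          (≈-trans (*-congˡ (proj₂ (reciprocal a≉0))) (*-identityʳ _))))))
        (-‿inverseʳ a′)
        where open RingProperties (CommutativeRing.ring (fieldRing F)) using (-‿distribˡ-*)
      Tu+dx∈ : Span ws (map T (u +ᴹ d *ₗ x))
      Tu+dx∈ = resp S (begin
        map T u +ᴹ a′ *ₗ w +ᴹ d *ₗ (map T x +ᴹ a *ₗ w)
          ≈⟨ +ᴹ-congˡ (≈ᴹ-trans (*ₗ-distribˡ d _ _) (+ᴹ-congˡ (≈ᴹ-sym (*ₗ-assoc d a w)))) ⟩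
        map T u +ᴹ a′ *ₗ w +ᴹ (d *ₗ map T x +ᴹ (d * a) *ₗ w)
          ≈⟨ interchange _ _ _ _ ⟩
        map T u +ᴹ d *ₗ map T x +ᴹ (a′ *ₗ w +ᴹ (d * a) *ₗ w)
          ≈⟨ +ᴹ-cong (≈ᴹ-sym (map-+* T)) (≈ᴹ-sym (*ₗ-distribʳ w a′ (d * a))) ⟩
        map T (u +ᴹ d *ₗ x) +ᴹ (a′ + d * a) *ₗ w
          ≈⟨ 0*-absorb _ w a′+da≈0 ⟩
        map T (u +ᴹ d *ₗ x) ∎)
        (+*-closed S d (proj₂ (T⊆ u∈X)) Tx+aw∈)

    unsp-ker : Unspannable ((X ∩ (Span ws ∘ map T)) ∩ ker T)
    unsp-ker = unspannable-∩-ker T ws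
      (∩-subspace X-sub (preimage-subspace T S)) unsp-preimage proj₂

  -- Kernels are intersected one at a time, each step preserving `Unspannable`. The clause on `us`
  -- sits under `All` to match the condition used in the fusion.
  common-kernel : Unspannable {p = c ⊔ ℓm} (λ _ → Lift _ ⊤) → ∀ Ts → All FiniteRank Ts →
                  ∀ us → ∃ λ v → All (λ T → ker T v × ¬ Span us v) Ts
  common-kernel unsp Ts fins us with go Ts fins
    where
    go : ∀ Ts → All FiniteRank Ts → ∃ λ (X : Pred Carrierᴹ (c ⊔ ℓm)) →
         IsSubspace X × Unspannable X × (∀ {u} → X u → All (λ T → ker T u) Ts)
    go [] [] = (λ _ → Lift _ ⊤) , record {} , unsp , λ _ → []
    go (T ∷ Ts) ((ws , T⊆) ∷ fins) with go Ts fins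
    ... | X , X-sub , X-unsp , X⊆ = X ∩ ker T , ∩-subspace X-sub (ker-subspace T)
      , unspannable-∩-ker T ws X-sub X-unsp (λ {u} _ → T⊆ u)
      , λ (u∈X , Tu≈0) → Tu≈0 ∷ X⊆ u∈X
  ... | X , _ , X-unsp , X⊆ with X-unsp us
  ... | v , v∈X , v∉ = v , All.map (_, v∉) (X⊆ v∈X)

-- Baire space, pairing and finite bit strings.

Baire : Set
Baire = ℕ → ℕ

U : Baire → ℕ → Pred Baire 0ℓ
U x n y = ∀ i → i < n → y i ≡ x i

U-refl : ∀ x n → U x n x
U-refl x n _ _ = refl

U-trans : ∀ {x y z k n} → k ≤ n → U x k y → U y n z → U x k z
U-trans k≤n y∈ z∈ i i<k = ≡.trans (z∈ i (<-≤-trans i<k k≤n)) (y∈ i i<k)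

U-join : ∀ {x y z k n} → k ≤ n → U x n y → U x n z → U y k z
U-join k≤n y∈ z∈ i i<k =
  ≡.trans (z∈ i (<-≤-trans i<k k≤n)) (≡.sym (y∈ i (<-≤-trans i<k k≤n)))

U-anti : ∀ {x y k n} → k ≤ n → U x n y → U x k y
U-anti k≤n y∈ i i<k = y∈ i (<-≤-trans i<k k≤n)

module Limit (x : ℕ → Baire) (r : ℕ → ℕ)
  (n≤r : ∀ n → n ≤ r n) (r-step : ∀ n → r n ≤ r (suc n))
  (x-step : ∀ n → U (x n) (r n) (x (suc n))) where

  -- Coordinate `i` is final from stage `suc i` on, since `r (suc i)` exceeds `i`.
  lim : Baire
  lim i = x (suc i) i

  private
    r-mono : ∀ {k n} → k ≤′ n → r k ≤ r n
    r-mono ≤′-refl       = ≤-refl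
    r-mono (≤′-step k≤n) = ≤-trans (r-mono k≤n) (r-step _)

    x-chain : ∀ {k n} → k ≤′ n → U (x k) (r k) (x n)
    x-chain ≤′-refl       = U-refl _ _
    x-chain (≤′-step k≤n) = U-trans (r-mono k≤n) (x-chain k≤n) (x-step _)

  lim∈U : ∀ n → U (x n) (r n) lim
  lim∈U n i i<r with ≤-total n (suc i)
  ... | inj₁ n≤1+i = x-chain (≤⇒≤′ n≤1+i) i i<r
  ... | inj₂ 1+i≤n = ≡.sym (x-chain (≤⇒≤′ 1+i≤n) i (n≤r (suc i)))

-- Traverses ℕ × ℕ along the antidiagonals.
unpair : ℕ → ℕ × ℕ
unpair zero    = 0 , 0
unpair (suc n) with unpair n
... | i , zero  = 0 , suc i
... | i , suc j = suc i , j

-- Induction on a bound for the sum, then on `i`: `(suc i , j)` comes right after `(i , suc j)`, and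
-- `(0 , suc j)` right after `(j , 0)`.
unpair-surjective : ∀ i j → ∃ λ n → unpair n ≡ (i , j)
unpair-surjective i j = go (suc (i +ᴺ j)) i j ≤-refl
  where
  go : ∀ s i j → i +ᴺ j < s → ∃ λ n → unpair n ≡ (i , j)
  go (suc s) zero zero _ = 0 , refl
  go (suc s) zero (suc j) (s≤s j<s)
    with go s j zero (subst (_< s) (≡.sym (+ᴺ-identityʳ j)) j<s)
  ... | n , eq = suc n , lemma
    where
    lemma : unpair (suc n) ≡ (0 , suc j)
    lemma rewrite eq = refl
  go (suc s) (suc i) j i+j<s
    with go (suc s) i (suc j) (subst (_< suc s) (≡.sym (+ᴺ-suc i j)) i+j<s)
  ... | n , eq = suc n , lemma
    where
    lemma : unpair (suc n) ≡ (suc i , j)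
    lemma rewrite eq = refl

bitVectors : ∀ n → List (Vec Bool n)
bitVectors zero    = [] ∷ []
bitVectors (suc n) = List.map (false ∷_) (bitVectors n) ++ List.map (true ∷_) (bitVectors n)

∈-bitVectors : ∀ {n} (σ : Vec Bool n) → σ ∈ᴸ bitVectors n
∈-bitVectors []          = here refl
∈-bitVectors (false ∷ σ) = ∈-++⁺ˡ (∈-map⁺ (false ∷_) (∈-bitVectors σ))
∈-bitVectors {suc n} (true ∷ σ) =
  ∈-++⁺ʳ (List.map (false ∷_) (bitVectors n)) (∈-map⁺ (true ∷_) (∈-bitVectors σ))

-- Most recent value first.
infix 8 _↾_
_↾_ : (ℕ → Bool) → ∀ n → Vec Bool n
α ↾ zero  = []
α ↾ suc n = α n ∷ α ↾ n

↾-cong : ∀ {α β} n → (∀ {i} → i < n → α i ≡ β i) → α ↾ n ≡ β ↾ n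
↾-cong zero    _   = refl
↾-cong (suc n) α≡β = ≡.cong₂ _∷_ (α≡β (n<1+n n)) (↾-cong n (α≡β ∘ m<n⇒m<1+n))

-- Continuity, countable images and kernel points.

module Topology (em : ∀ {ℓ} → ExcludedMiddle ℓ)
  {c ℓ₁ ℓ₂ m ℓm : Level} (F : HeytingField c ℓ₁ ℓ₂)
  (E : Module (fieldRing F) m ℓm)
  (e : ℕ → Module.Carrierᴹ E) (e-basis : VectorSpace.IsBasis F E e)
  (f : Baire → VectorSpace.Lin F E) (f-continuous : VectorSpace.Continuous F E f) where

  open LinearAlgebra em F E
  open Basis e e-basis

  ≈[]-trans : ∀ {S T R us} → S ≈[ us ] T → T ≈[ us ] R → S ≈[ us ] R
  ≈[]-trans S≈T T≈R = All.zipWith (λ (x , y) → ≈ᴹ-trans x y) (S≈T , T≈R)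

  ≈ᴸ⇒≈[] : ∀ {S T} us → S ≈ᴸ T → S ≈[ us ] T
  ≈ᴸ⇒≈[] us S≈T = All.universal S≈T us

  bound : ∀ ks → ∃ λ n → All (_< n) ks
  bound []       = 0 , []
  bound (k ∷ ks) with bound ks
  ... | n , ks<n = suc k ⊔ᴺ n , m≤m⊔n (suc k) n ∷
    All.map (λ i<n → <-≤-trans i<n (m≤n⊔m (suc k) n)) ks<n

  -- Bounds the finitely many coordinates supplied by continuity, so that initial segments replace
  -- arbitrary finite coordinate sets.
  modulus : Baire → List Carrierᴹ → ℕ
  modulus x us = proj₁ (bound (proj₁ (f-continuous x us)))

  modulus-correct : ∀ {x us y n} → modulus x us ≤ n → U x n y → f y ≈[ us ] f x
  modulus-correct {x} {us} {y} mod≤n y∈ =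
    proj₂ (f-continuous x us) y (All.map (λ {i} i< → y∈ i (<-≤-trans i< mod≤n))
      (proj₂ (bound (proj₁ (f-continuous x us)))))

  modulus-correct₁ : ∀ {x u y n} → modulus x (u ∷ []) ≤ n → U x n y →
                     map (f y) u ≈ᴹ map (f x) u
  modulus-correct₁ mod≤n y∈ = All.head (modulus-correct mod≤n y∈)

  -- f[B] is countable; the enumeration may have repetitions and junk values.
  Small : Pred Baire p → Set (c ⊔ m ⊔ ℓm ⊔ p)
  Small B = Σ (ℕ → Lin) λ g → ∀ x → B x → ∃ λ n → g n ≈ᴸ f x

  Large : Pred Baire p → Set (c ⊔ m ⊔ ℓm ⊔ p)
  Large B = ¬ Small B

  large-mono : {B : Pred Baire p} {C : Pred Baire q} → B ⊆ C → Large B → Large C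
  large-mono B⊆C B-large (g , g-onto) = B-large (g , λ x x∈B → g-onto x (B⊆C x∈B))

  large⇒inhabited : {B : Pred Baire p} → Large B → ∃ B
  large⇒inhabited B-large = byContradiction em λ ¬∃ →
    -- Any map serves to enumerate the empty image.
    B-large ((λ _ → f (λ _ → 0)) , λ x x∈B → ⊥-elim (¬∃ (x , x∈B)))

  -- Contrapositive of: a countable union of countable images is countable.
  large-⋃ : {B : Pred Baire p} (C : ℕ → Pred Baire q) → (∀ {x} → B x → ∃ λ n → C n x) →
            Large B → ∃ λ n → Large (C n)
  large-⋃ {B = B} C B⊆⋃C B-large = byContradiction em λ ¬∃ →
    let small : ∀ n → Small (C n)
        small n = byContradiction em λ Cn-large → ¬∃ (n , Cn-large)
    in B-large (enumerate small , cover small)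
    where
    module _ (small : ∀ n → Small (C n)) where
      enumerate : ℕ → Lin
      enumerate n = let i , j = unpair n in proj₁ (small i) j
      cover : ∀ x → B x → ∃ λ n → enumerate n ≈ᴸ f x
      cover x x∈B with B⊆⋃C x∈B
      ... | i , x∈Ci with proj₂ (small i) x x∈Ci
      ... | j , gj≈fx with unpair-surjective i j
      ... | n , eq = n , subst (λ (i , j) → proj₁ (small i) j ≈ᴸ f x) (≡.sym eq) gj≈fx

  -- Fixing one more coordinate splits a set into countably many pieces, and a large set has a large
  -- piece; the nested choices converge. The limit need not lie in `B`.
  condensation : {B : Pred Baire p} → Large B → ∃ λ x → ∀ n → Large (B ∩ U x n)
  condensation {B = B} B-large = lim , λ n → large-mono
      (λ (x∈B , x∈U) → x∈B , U-join ≤-refl (lim∈U n) x∈U) (proj₂ (approx n))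
    where
    next : ∀ {n x} → Large (B ∩ U x n) → ∃ λ y → U x n y × Large (B ∩ U y (suc n))
    next {n} {x} large
      with large-⋃ (λ k y → (B ∩ U x n) y × y n ≡ k) (λ y∈ → _ , y∈ , refl) large
    ... | k , largeₖ with large⇒inhabited largeₖ
    ... | y , (y∈B , y∈U) , yn≡k = y , y∈U , large-mono
      (λ ((z∈B , z∈U) , zn≡k) → z∈B , λ i i<1+n → agree z∈U zn≡k (m<1+n⇒m<n∨m≡n i<1+n))
      largeₖ
      where
      agree : ∀ {z i} → U x n z → z n ≡ k → i < n ⊎ i ≡ n → z i ≡ y i
      agree z∈U zn≡k (inj₁ i<n)  = ≡.trans (z∈U _ i<n) (≡.sym (y∈U _ i<n))
      agree z∈U zn≡k (inj₂ refl) = ≡.trans zn≡k (≡.sym yn≡k)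

    approx : ∀ n → ∃ λ x → Large (B ∩ U x n)
    approx zero    = (λ _ → 0) , large-mono (λ x∈B → x∈B , λ _ ()) B-large
    approx (suc n) = proj₁ y , proj₂ (proj₂ y)
      where y = next (proj₂ (approx n))

    approx-step : ∀ n → U (proj₁ (approx n)) n (proj₁ (approx (suc n)))
    approx-step n = proj₁ (proj₂ (next (proj₂ (approx n))))

    open Limit (proj₁ ∘ approx) id (λ _ → ≤-refl) n≤1+n approx-step

  Kernel : Pred Baire (c ⊔ m ⊔ ℓm)
  Kernel x = ∀ n → Large (U x n)

  -- Points with the same image as `x` form a small set, so for some `e j` the nearby points whose
  -- image differs from `f x` at `e j` form a large one. Its condensation point inherits nearness
  -- and, by continuity of `f`, the difference.
  kernel-split : ∀ {x} → Kernel x → ∀ n →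
                 ∃ λ y → Kernel y × U x n y × ∃ λ u → ¬ (map (f y) u ≈ᴹ map (f x) u)
  kernel-split {x} x∈K n with large-⋃ C cover (x∈K n)
    where
    C : ℕ → Pred Baire _
    C zero    y = f x ≈ᴸ f y
    C (suc j) y = Lift m (U x n y) × ¬ (map (f y) (e j) ≈ᴹ map (f x) (e j))
    cover : ∀ {y} → U x n y → ∃ λ j → C j y
    cover {y} y∈U with em {P = ∃ λ j → ¬ (map (f y) (e j) ≈ᴹ map (f x) (e j))}
    ... | yes (j , ≉) = suc j , lift y∈U , ≉
    ... | no ¬∃       = zero , ext-on-basis {f x} {f y}
      λ j → byContradiction em λ ≉ → ¬∃ (j , ≉ ∘ ≈ᴹ-sym)
  ... | zero  , large = ⊥-elim (large ((λ _ → f x) , λ _ fx≈fy → 0 , fx≈fy))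
  ... | suc j , large with condensation large
  ... | y , y-large = y , (λ k → large-mono proj₂ (y-large k)) , y∈U , e j , differs
    where
    y∈U : U x n y
    y∈U with large⇒inhabited (y-large n)
    ... | z , (lift z∈Ux , _) , z∈Uy = λ i i<n → ≡.trans (≡.sym (z∈Uy i i<n)) (z∈Ux i i<n)
    differs : ¬ (map (f y) (e j) ≈ᴹ map (f x) (e j))
    differs fy≈fx with large⇒inhabited (y-large (modulus y (e j ∷ [])))
    ... | z , (_ , fz≉fx) , z∈Uy = fz≉fx (≈ᴹ-trans (modulus-correct₁ ≤-refl z∈Uy) fy≈fx)

  -- Fusion along the binary tree.

  -- G is the set of points that may occur in the scheme, and R T us v is what is
  -- asked of the next vector v at a map T of the scheme, us being the vectors
  -- that v has to avoid.
  module Fusion {g r : Level} (G : Pred Baire g)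
    (R : Lin → List Carrierᴹ → Pred Carrierᴹ r)
    (R-resp : ∀ {S T us v} → S ≈[ v ∷ us ] T → R T us v → R S us v)
    (choose : ∀ xs → All G xs → ∀ us → ∃ λ v → All (λ x → R (f x) us v) xs)
    (root : ∃ G)
    (split : ∀ {x} → G x → ∀ n →
             ∃ λ y → G y × U x n y × ∃ λ u → ¬ (map (f y) u ≈ᴹ map (f x) u)) where

    chooseFor : ∀ (xs : List (∃ G)) us →
                ∃ λ v → All (λ x → R (f x) us v) (List.map proj₁ xs)
    chooseFor xs = choose (List.map proj₁ xs) (All.map⁺ (All.universal proj₂ xs))

    -- The child false ∷ σ keeps the point of σ, and the child true ∷ σ gets a
    -- new point.  settling n σ is a depth below which f is constant on settled n.
    avoided settled : ℕ → List Carrierᴹ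
    v : ℕ → Carrierᴹ
    point : ∀ n → Vec Bool n → ∃ G
    radius settling : ∀ n → Vec Bool n → ℕ
    sibling : ∀ n (σ : Vec Bool n) → ∃ λ y →
      G y × U (proj₁ (point n σ)) (settling n σ) y ×
      ∃ λ u → ¬ (map (f y) u ≈ᴹ map (f (proj₁ (point n σ))) u)

    avoided zero    = []
    avoided (suc n) = settled n
    -- `e n` is listed too, so that later vectors can be kept off the span of the initial basis
    -- vectors; infinite dimension of `V` rests on this.
    settled n = v n ∷ e n ∷ avoided n
    v n = proj₁ (chooseFor (List.map (point n) (bitVectors n)) (avoided n))
    point zero    _           = root
    point (suc n) (false ∷ σ) = point n σ
    point (suc n) (true  ∷ σ) = proj₁ (sibling n σ) , proj₁ (proj₂ (sibling n σ))
    -- Three demands: depth for convergence, nesting in the current cell, and constancy of `f` on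
    -- the settled vectors.
    settling n σ = suc n ⊔ᴺ (radius n σ ⊔ᴺ modulus (proj₁ (point n σ)) (settled n))
    radius zero    _       = 0
    -- The images of the point of `σ` and of its sibling differ at `u`; at this depth the value at
    -- `u` is constant on each child cell.
    radius (suc n) (b ∷ σ) = settling n σ ⊔ᴺ
      (modulus (proj₁ (point n σ)) (u ∷ []) ⊔ᴺ modulus (proj₁ (sibling n σ)) (u ∷ []))
      where u = proj₁ (proj₂ (proj₂ (proj₂ (sibling n σ))))
    sibling n σ = split (proj₂ (point n σ)) (settling n σ)

    n≤radius : ∀ n σ → n ≤ radius n σ
    n≤radius zero    σ       = z≤n
    n≤radius (suc n) (b ∷ σ) = ≤-trans
      (m≤m⊔n (suc n) (radius n σ ⊔ᴺ modulus (proj₁ (point n σ)) (settled n)))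
      (m≤m⊔n (settling n σ) _)

    radius≤settling : ∀ n σ → radius n σ ≤ settling n σ
    radius≤settling n σ = ≤-trans
      (m≤m⊔n (radius n σ) (modulus (proj₁ (point n σ)) (settled n))) (m≤n⊔m (suc n) _)

    settling≤radius : ∀ n b σ → settling n σ ≤ radius (suc n) (b ∷ σ)
    settling≤radius n b σ = m≤m⊔n (settling n σ) _

    cell : ∀ n → Vec Bool n → Pred Baire 0ℓ
    cell n σ = U (proj₁ (point n σ)) (radius n σ)

    child∈U : ∀ n b σ → U (proj₁ (point n σ)) (settling n σ) (proj₁ (point (suc n) (b ∷ σ)))
    child∈U n false σ = U-refl _ (settling n σ)
    child∈U n true  σ = proj₁ (proj₂ (proj₂ (sibling n σ)))

    cell-settled : ∀ n b σ {x} → cell (suc n) (b ∷ σ) x →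
                   f x ≈[ settled n ] f (proj₁ (point n σ))
    cell-settled n b σ x∈ = modulus-correct
      (≤-trans (m≤n⊔m (radius n σ) (modulus (proj₁ (point n σ)) (settled n)))
               (m≤n⊔m (suc n) _))
      (U-trans (settling≤radius n b σ) (child∈U n b σ) x∈)

    cell-separated : ∀ n σ {x y} → cell (suc n) (false ∷ σ) x → cell (suc n) (true ∷ σ) y →
                     ¬ (f x ≈ᴸ f y)
    cell-separated n σ {x} {y} x∈ y∈ fx≈fy with proj₂ (proj₂ (proj₂ (sibling n σ)))
    ... | u , differs = differs (≈ᴹ-trans
      (≈ᴹ-sym (modulus-correct₁ (≤-trans (m≤n⊔m _ _) (m≤n⊔m (settling n σ) _)) y∈))
      (≈ᴹ-trans (≈ᴹ-sym (fx≈fy u))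
        (modulus-correct₁ (≤-trans (m≤m⊔n _ _) (m≤n⊔m (settling n σ) _)) x∈)))

    module Branch (α : ℕ → Bool) where
      open Limit (λ n → proj₁ (point n (α ↾ n))) (λ n → radius n (α ↾ n))
        (λ n → n≤radius n (α ↾ n))
        (λ n → ≤-trans (radius≤settling n (α ↾ n)) (settling≤radius n (α n) (α ↾ n)))
        (λ n → U-anti (radius≤settling n (α ↾ n)) (child∈U n (α n) (α ↾ n)))
        public

    branch : (ℕ → Bool) → Baire
    branch α = Branch.lim α

    branch∈cell : ∀ α n → cell n (α ↾ n) (branch α)
    branch∈cell α = Branch.lim∈U α

    -- This is the continuity of `branch` on Cantor space.
    branch-U : ∀ {α β} n → β ↾ n ≡ α ↾ n → U (branch α) n (branch β)
    branch-U {α} {β} n β≡α = U-join (n≤radius n (α ↾ n)) (branch∈cell α n)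
      (subst (λ σ → cell n σ (branch β)) β≡α (branch∈cell β n))

    branch-separated : ∀ {α β} n → α ↾ n ≡ β ↾ n → α n ≡ false → β n ≡ true →
                       ¬ (f (branch α) ≈ᴸ f (branch β))
    branch-separated {α} {β} n α≡β αn≡f βn≡t = cell-separated n (β ↾ n)
      (subst (λ σ → cell (suc n) σ (branch α)) (≡.cong₂ _∷_ αn≡f α≡β) (branch∈cell α (suc n)))
      (subst (λ b → cell (suc n) (b ∷ β ↾ n) (branch β)) βn≡t (branch∈cell β (suc n)))

    P : Pred Lin (m ⊔ ℓm)
    P T = ∃ λ α → f (branch α) ≈ᴸ T

    -- `v n` was chosen to satisfy `R` at the point of `α ↾ n`; the whole next cell along `α` has
    -- the same values at the vectors concerned, so `R-resp` carries the condition to the branch.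
    P-R : ∀ T → P T → ∀ n → R T (avoided n) (v n)
    P-R T (α , fα≈T) n = R-resp
      (≈[]-trans {T} {f (branch α)} {f (proj₁ (point n (α ↾ n)))}
        (≈ᴸ⇒≈[] {T} {f (branch α)} (v n ∷ avoided n) (λ u → ≈ᴹ-sym (fα≈T u)))
        (drop-e {f (branch α)} {f (proj₁ (point n (α ↾ n)))}
          (cell-settled n (α n) (α ↾ n) (branch∈cell α (suc n)))))
      (All.lookup (All.map⁻ (All.map⁻
        (proj₂ (chooseFor (List.map (point n) (bitVectors n)) (avoided n)))))
        (∈-bitVectors (α ↾ n)))
      where
      drop-e : ∀ {S T} → S ≈[ settled n ] T → S ≈[ v n ∷ avoided n ] T
      drop-e (x ∷ _ ∷ xs) = x ∷ xs

    -- Compactness of Cantor space, in the form of König's lemma: `path` follows bit strings whose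
    -- extensions approximate `T` on every finite set.
    P-closed : Closed P
    P-closed T T∈cl = α , fα≈T
      where
      Near : ∀ n → Vec Bool n → Set _
      Near n σ = ∀ us → ∃ λ β → β ↾ n ≡ σ × f (branch β) ≈[ us ] T

      extend : ∀ {n σ} → Near n σ → ∃ λ b → Near (suc n) (b ∷ σ)
      -- If both children failed, the concatenation of their test lists would refute `near`.
      extend {n} {σ} near = byContradiction em λ ¬∃ →
        let us₀ , far₀ = ¬∀⇒∃¬ em (λ near₀ → ¬∃ (false , near₀))
            us₁ , far₁ = ¬∀⇒∃¬ em (λ near₁ → ¬∃ (true , near₁))
        in refute us₀ us₁ far₀ far₁
        where
        refute : ∀ us₀ us₁ →
          ¬ (∃ λ β → β ↾ suc n ≡ false ∷ σ × f (branch β) ≈[ us₀ ] T) →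
          ¬ (∃ λ β → β ↾ suc n ≡ true ∷ σ × f (branch β) ≈[ us₁ ] T) → ⊥
        refute us₀ us₁ far₀ far₁ with near (us₀ ++ us₁)
        ... | β , β≡σ , fβ≈T with β n in βn≡
        ...   | false = far₀ (β , ≡.cong₂ _∷_ βn≡ β≡σ , All.++⁻ˡ us₀ fβ≈T)
        ...   | true  = far₁ (β , ≡.cong₂ _∷_ βn≡ β≡σ , All.++⁻ʳ us₀ fβ≈T)

      path : ∀ n → ∃ (Near n)
      path zero    = [] , λ us → let S , (β , fβ≈S) , S≈T = T∈cl us in
        β , refl , ≈[]-trans {f (branch β)} {S} {T}
          (≈ᴸ⇒≈[] {f (branch β)} {S} us fβ≈S) S≈T
      path (suc n) = proj₁ (extend (proj₂ (path n))) ∷ proj₁ (path n)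
                   , proj₂ (extend (proj₂ (path n)))

      α : ℕ → Bool
      α n = proj₁ (extend (proj₂ (path n)))

      α↾≡path : ∀ n → α ↾ n ≡ proj₁ (path n)
      α↾≡path zero    = refl
      α↾≡path (suc n) = cong (α n ∷_) (α↾≡path n)

      fα≈T : f (branch α) ≈ᴸ T
      -- A long enough initial segment of `α` fixes the value at `u`, and the branch of some `β`
      -- sharing that segment takes the value of `T` there.
      fα≈T u with modulus (branch α) (u ∷ []) in mod≡
      ... | n with proj₂ (path n) (u ∷ [])
      ... | β , β≡ , fβ≈T = ≈ᴹ-trans
        (≈ᴹ-sym (modulus-correct₁ (≤-reflexive mod≡)
          (branch-U n (≡.trans β≡ (≡.sym (α↾≡path n))))))
        (All.head fβ≈T)

    -- Flipping the bit of `α` at the modulus of its branch leaves the values on `us` unchanged, yet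
    -- separates the images.
    P-noIsolatedPoints : NoIsolatedPoints P
    P-noIsolatedPoints T (α , fα≈T) us = f (branch β) , (β , λ _ → ≈ᴹ-refl)
      , ≈[]-trans {f (branch β)} {f (branch α)} {T}
          (modulus-correct ≤-refl (branch-U n β↾≡α↾))
          (≈ᴸ⇒≈[] {f (branch α)} {T} us fα≈T)
      , λ fβ≈T → differ (λ u → ≈ᴹ-trans (fβ≈T u) (≈ᴹ-sym (fα≈T u)))
      where
      n = modulus (branch α) us
      β : ℕ → Bool
      β i = if does (i ≟ n) then not (α n) else α i
      β↾≡α↾ : β ↾ n ≡ α ↾ n
      β↾≡α↾ = ↾-cong n λ {i} i<n →
        cong (if_then not (α n) else α i) (dec-false (i ≟ n) (<⇒≢ i<n))
      βn≡ : β n ≡ not (α n)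
      βn≡ = cong (if_then not (α n) else α n) (dec-true (n ≟ n) refl)
      differ : ¬ (f (branch β) ≈ᴸ f (branch α))
      differ fβ≈fα = by-cases (α n) refl
        where
        by-cases : ∀ b → ¬ (α n ≡ b)
        by-cases true αn≡ =
          branch-separated n β↾≡α↾ (≡.trans βn≡ (cong not αn≡)) αn≡ fβ≈fα
        by-cases false αn≡ =
          branch-separated n (≡.sym β↾≡α↾) αn≡ (≡.trans βn≡ (cong not αn≡))
            (λ u → ≈ᴹ-sym (fβ≈fα u))

    V : Pred Carrierᴹ (c ⊔ ℓm)
    V u = ∃ λ n → Span (prefix v n) u

    V-subspace : IsSubspace V
    V-subspace = record
      { resp     = λ u≈w (n , u∈) → n , resp (span-subspace (prefix v n)) u≈w u∈
      ; 0-closed = 0 , lift ≈ᴹ-refl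
      ; +-closed = λ (k , u∈) (n , w∈) → k ⊔ᴺ n ,
          +-closed (span-subspace (prefix v (k ⊔ᴺ n)))
            (prefix-mono v (m≤m⊔n k n) u∈) (prefix-mono v (m≤n⊔m k n) w∈)
      ; *-closed = λ a (n , u∈) → n , *-closed (span-subspace (prefix v n)) a u∈
      }

    V-infiniteDimensional : (∀ n → ¬ Span (avoided n) (v n)) → InfiniteDimensional V
    V-infiniteDimensional v-avoids = unspannable⇒infiniteDimensional
      (escaping⇒unspannable v (λ n → suc n , span-head {v n} {prefix v n})
        (λ n → v-avoids n ∘ prefix-e⊆avoided n))
      where
      prefix-e⊆avoided : ∀ n → Span (prefix e n) ⊆ Span (avoided n)
      prefix-e⊆avoided zero    u∈       = u∈
      prefix-e⊆avoided (suc n) (a , u∈) =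
        span-∷ {v n} {e n ∷ avoided n} (a , prefix-e⊆avoided n u∈)

    -- Weakens avoidance of all settled images to avoidance of those of the earlier `v`, the form
    -- that injectivity on `V` uses.
    prefix-v⊆avoided : ∀ T n → Span (List.map (map T) (prefix v n)) ⊆
                               Span (List.map (map T) (avoided n))
    prefix-v⊆avoided T zero    u∈       = u∈
    prefix-v⊆avoided T (suc n) (a , u∈) =
      a , span-∷ {map T (e n)} {List.map (map T) (avoided n)} (prefix-v⊆avoided T n u∈)

    P-satisfiable : Satisfiable P
    P-satisfiable = f (branch (λ _ → false)) , (λ _ → false) , λ _ → ≈ᴹ-refl

  -- The conditions on new vectors in the two cases.

  module KernelCase (G : Pred Baire (c ⊔ m ⊔ ℓm))
    (finiteRank : ∀ {x} → G x → FiniteRank (f x)) where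
    R : Lin → List Carrierᴹ → Pred Carrierᴹ (c ⊔ ℓm)
    R T us v = ker T v × ¬ Span us v

    R-resp : ∀ {S T us v} → S ≈[ v ∷ us ] T → R T us v → R S us v
    R-resp (Sv≈Tv ∷ _) (Tv≈0 , v∉) = ≈ᴹ-trans Sv≈Tv Tv≈0 , v∉

    choose : ∀ xs → All G xs → ∀ us → ∃ λ v → All (λ x → R (f x) us v) xs
    choose xs good us with common-kernel
      (escaping⇒unspannable e (λ _ → lift tt) basis-fresh)
      (List.map f xs) (All.map⁺ (All.map finiteRank good)) us
    ... | v , Rs = v , All.map⁻ Rs

  module InjectiveCase (G : Pred Baire (c ⊔ m ⊔ ℓm))
    (infiniteRank : ∀ {x} → G x → ¬ FiniteRank (f x)) where
    -- Also keeps `v` off the span of `us`, because `T` maps that span into the span of the images.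
    R : Lin → List Carrierᴹ → Pred Carrierᴹ (c ⊔ ℓm)
    R T us v = ¬ Span (List.map (map T) us) (map T v)

    R-resp : ∀ {S T us v} → S ≈[ v ∷ us ] T → R T us v → R S us v
    R-resp {S} {T} {us} {v} (Sv≈Tv ∷ S≈T) Tv∉ Sv∈ = Tv∉
      (resp (span-subspace (List.map (map T) us)) Sv≈Tv
        (span-map-cong {T} {S} us (All.map ≈ᴹ-sym S≈T) Sv∈))

    choose : ∀ xs → All G xs → ∀ us → ∃ λ v → All (λ x → R (f x) us v) xs
    choose xs good us with jointly-avoid (List.map f xs) (All.map⁺ (All.map infiniteRank good))
                                         (λ T → List.map (map T) us)
    ... | v , Rs = v , All.map⁻ Rs

  -- A nonzero coefficient of the newest vector would put its image in the span of the earlier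
  -- images, so a kernel vector loses its coefficients from the newest downwards.
  injective-on-span : ∀ T v → (∀ n → ¬ Span (List.map (map T) (prefix v n)) (map T (v n))) →
                      ∀ n {u} → Span (prefix v n) u → map T u ≈ᴹ 0ᴹ → u ≈ᴹ 0ᴹ
  injective-on-span T v Tv∉ zero    (lift u≈0) Tu≈0 = u≈0
  injective-on-span T v Tv∉ (suc n) {u} (a , u+av∈) Tu≈0 with em {P = a ≈ 0#}
  ... | yes a≈0 = injective-on-span T v Tv∉ n
    (resp (span-subspace (prefix v n)) (0*-absorb u (v n) a≈0) u+av∈) Tu≈0
  ... | no a≉0 = ⊥-elim (Tv∉ n (*-cancel S a≉0 (+-cancelˡ S
      (resp S (≈ᴹ-sym Tu≈0) (0-closed S))
      (resp S (map-+* T) (span-map T (prefix v n) u+av∈)))))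
    where S = span-subspace (List.map (map T) (prefix v n))

  trivial-kernel⇒injective : ∀ T {X : Pred Carrierᴹ p} → IsSubspace X →
    (∀ {u} → X u → map T u ≈ᴹ 0ᴹ → u ≈ᴹ 0ᴹ) → InjectiveOn X T
  trivial-kernel⇒injective T X-sub trivial {u} {w} u∈X w∈X Tu≈Tw = begin
    u                          ≈⟨ +ᴹ-*-cancel u w (-‿inverseˡ 1#) ⟨
    u +ᴹ - 1# *ₗ w +ᴹ 1# *ₗ w
      ≈⟨ +ᴹ-congʳ (trivial (+*-closed X-sub (- 1#) u∈X w∈X) T-difference) ⟩
    0ᴹ +ᴹ 1# *ₗ w              ≈⟨ ≈ᴹ-trans (+ᴹ-identityˡ _) (*ₗ-identityˡ w) ⟩
    w                          ∎
    where
    open SetoidReasoning ≈ᴹ-setoid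
    T-difference : map T (u +ᴹ - 1# *ₗ w) ≈ᴹ 0ᴹ
    T-difference = begin
      map T (u +ᴹ - 1# *ₗ w)      ≈⟨ map-+* T ⟩
      map T u +ᴹ - 1# *ₗ map T w  ≈⟨ +ᴹ-congʳ Tu≈Tw ⟩
      map T w +ᴹ - 1# *ₗ map T w  ≈⟨ x-1*x≈0 (map T w) ⟩
      0ᴹ                          ∎

  -- The dichotomy and the passage to analytic sets.

  module _ (all-large : Large {p = 0ℓ} (λ _ → ⊤)) where

    ∃kernel : ∃ Kernel
    ∃kernel with condensation all-large
    ... | x , x-large = x , large-mono proj₂ ∘ x-large

    dichotomy : Σ (Pred Lin (m ⊔ ℓm)) λ P → Σ (Pred Carrierᴹ (c ⊔ ℓm)) λ V →
      Satisfiable P × Perfect P × (P ⊆ λ T → ∃ λ x → f x ≈ᴸ T) ×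
      IsSubspace V × InfiniteDimensional V ×
      ((∀ T → P T → V ⊆ ker T) ⊎ (∀ T → P T → InjectiveOn V T))
    dichotomy
      with em {P = ∃₂ λ x n → Kernel x × (∀ {y} → Kernel y → U x n y → FiniteRank (f y))}
    ... | yes (x₀ , n₀ , x₀∈K , finiteRank) =
      P , V , P-satisfiable , (P-closed , P-noIsolatedPoints)
        , (λ (α , fα≈T) → branch α , fα≈T)
        , V-subspace , V-infiniteDimensional
            (λ n → proj₂ (P-R (proj₁ P-satisfiable) (proj₂ P-satisfiable) n))
        , inj₁ λ T T∈P (n , u∈) → span-least (ker-subspace T) (v∈ker T T∈P n) u∈
      where
      G : Pred Baire (c ⊔ m ⊔ ℓm)
      G y = Kernel y × U x₀ n₀ y
      open KernelCase G (λ (y∈K , y∈U) → finiteRank y∈K y∈U)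
      split : ∀ {x} → G x → ∀ n →
              ∃ λ y → G y × U x n y × ∃ λ u → ¬ (map (f y) u ≈ᴹ map (f x) u)
      -- Depth at least `n₀` keeps the new point in the neighbourhood where kernel points give
      -- finite rank.
      split (x∈K , x∈U) n with kernel-split x∈K (n₀ ⊔ᴺ n)
      ... | y , y∈K , y∈U , differs = y , (y∈K , U-trans (m≤m⊔n n₀ n) x∈U y∈U)
                                    , U-anti (m≤n⊔m n₀ n) y∈U , differs
      open Fusion G R (λ {S} {T} → R-resp {S} {T}) choose (x₀ , x₀∈K , U-refl x₀ n₀) split
      v∈ker : ∀ T → P T → ∀ n → All (ker T) (prefix v n)
      v∈ker T T∈P zero    = []
      v∈ker T T∈P (suc n) = proj₁ (P-R T T∈P n) ∷ v∈ker T T∈P n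
    ... | no ¬finite =
      P , V , P-satisfiable , (P-closed , P-noIsolatedPoints)
        , (λ (α , fα≈T) → branch α , fα≈T)
        , V-subspace , V-infiniteDimensional
            (λ n v∈ → P-R (proj₁ P-satisfiable) (proj₂ P-satisfiable) n
              (span-map (proj₁ P-satisfiable) (avoided n) v∈))
        , inj₂ λ T T∈P → trivial-kernel⇒injective T V-subspace λ (n , u∈) →
            injective-on-span T v (λ k → P-R T T∈P k ∘ prefix-v⊆avoided T k) n u∈
      where
      G : Pred Baire (c ⊔ m ⊔ ℓm)
      G y = Kernel y × ¬ FiniteRank (f y)
      open InjectiveCase G proj₂
      dense : ∀ {x} → Kernel x → ∀ n → ∃ λ y → G y × U x n y
      -- A failure of density at `x` and `n` would be an instance of the first case.
      dense {x} x∈K n = byContradiction em λ ¬∃ → ¬finite (x , n , x∈K , λ {y} y∈K y∈U →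
        byContradiction em λ ¬fin → ¬∃ (y , (y∈K , ¬fin) , y∈U))
      split : ∀ {x} → G x → ∀ n →
              ∃ λ y → G y × U x n y × ∃ λ u → ¬ (map (f y) u ≈ᴹ map (f x) u)
      split (x∈K , _) n with kernel-split x∈K n
      -- `f y` may have finite rank. It gives way to an infinite-rank `f z` with `z` so near `y`
      -- that both agree at `u`.
      ... | y , y∈K , y∈U , u , differs with dense y∈K (n ⊔ᴺ modulus y (u ∷ []))
      ... | z , z∈G , z∈U = z , z∈G , U-trans (m≤m⊔n n _) y∈U z∈U
        , u , λ fz≈fx → differs (≈ᴹ-trans (≈ᴹ-sym (modulus-correct₁ (m≤n⊔m n _) z∈U)) fz≈fx)
      root : ∃ G
      root with dense (proj₂ ∃kernel) 0
      ... | y , y∈G , _ = y , y∈G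
      open Fusion G R (λ {S} {T} → R-resp {S} {T}) choose root split

  -- The index of a map is its least occurrence in `g`; minimality makes it independent of the
  -- representative, as an injection of setoids demands.
  small⇒countable : (A : Pred Lin p) → (∀ T → A T → ∃ λ x → f x ≈ᴸ T) →
                    Small {p = 0ℓ} (λ _ → ⊤) → CountableSubset A
  small⇒countable A A⊆ (g , g-onto) = record
    { to        = λ (T , T∈A) → proj₁ (index T T∈A)
    ; cong      = λ { {T , T∈A} {S , S∈A} T≈S → ≤-antisym
        (proj₂ (proj₂ (index T T∈A)) _ λ u →
          ≈ᴹ-trans (proj₁ (proj₂ (index S S∈A)) u) (≈ᴹ-sym (T≈S u)))
        (proj₂ (proj₂ (index S S∈A)) _ λ u →
          ≈ᴹ-trans (proj₁ (proj₂ (index T T∈A)) u) (T≈S u)) }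
    ; injective = λ { {T , T∈A} {S , S∈A} i≡j u → ≈ᴹ-trans
        (≈ᴹ-sym (proj₁ (proj₂ (index T T∈A)) u))
        (subst (λ i → map (g i) u ≈ᴹ map S u) (≡.sym i≡j) (proj₁ (proj₂ (index S S∈A)) u)) }
    }
    where
    index : ∀ T → A T → ∃ λ n → g n ≈ᴸ T × (∀ k → g k ≈ᴸ T → n ≤ k)
    index T T∈A with A⊆ T T∈A
    ... | x , fx≈T with g-onto x tt
    ... | n , gn≈fx = least em (n , λ u → ≈ᴹ-trans (gn≈fx u) (fx≈T u))

theorem2p1 :
    (∀ {ℓ} → ExcludedMiddle ℓ) →
    ∀ {c ℓ₁ ℓ₂ m ℓm a : Level}
    (F : HeytingField c ℓ₁ ℓ₂) → Countable (fieldSetoid F) →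
    (E : Module (fieldRing F) m ℓm) →
    let open Module E using (Carrierᴹ)
        open VectorSpace F E
    in
    (e : ℕ → Carrierᴹ) → IsBasis e →
    (A : Pred Lin a) → Analytic A → ¬ CountableSubset A →
    Σ (Pred Lin (m ⊔ ℓm)) λ P →
    Σ (Pred Carrierᴹ (c ⊔ ℓm)) λ V →
      Satisfiable P × Perfect P × P ⊆ A ×
      IsSubspace V × InfiniteDimensional V ×
      ((∀ T → P T → V ⊆ ker T) ⊎ (∀ T → P T → InjectiveOn V T))
theorem2p1 em F _ E e e-basis A (inj₁ A-empty) A-uncountable = ⊥-elim (A-uncountable record
  { to        = λ _ → 0
  ; cong      = λ _ → refl
  ; injective = λ { {T , T∈A} _ → ⊥-elim (A-empty T T∈A) }
  })
theorem2p1 em F _ E e e-basis A (inj₂ (f , f-continuous , A⇔)) A-uncountable =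
  let P , V , P-sat , P-perfect , P⊆ , rest = dichotomy
        (λ small → A-uncountable (small⇒countable A (λ T → Equivalence.to (A⇔ T)) small))
  in P , V , P-sat , P-perfect , (λ {T} T∈P → Equivalence.from (A⇔ T) (P⊆ T∈P)) , rest
  where open Topology em F E e e-basis f f-continuous
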